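{- Let $M$ be the torus and suppose a $2,\!6$-quadrangulation of $M$ is given, i.e. a map on $M$ all of whose faces are quadrilaterals, in which every vertex has degree $4$ except for exactly two vertices, one of degree $2$ and one of degree $6$. Then the edges of this quadrangulation cannot be colored with two colors such that colors alternate around each face (equivalently, around each vertex).
   Context: A map on a closed connected surface $M$ is an embedding of a finite graph $G$ in $M$ such that every face (connected component of $M\smallsetminus G$) is an open disk. Here a graph is a one-dimensional cell complex, so loops and multiple edges are allowed. A face is a $k$-gon if its boundary walk has $k$ edges (counted with multiplicity). A quadrangulation is a map all of whose faces are quadrilaterals. The degree of a vertex counts edge-ends (a loop contributes $2$). -}

module Defs where

open import Algebra.Definitions using (Involutive)
open import Data.Bool.Base using (Bool)
open import Data.Fin.Base using (Fin)
open import Data.Fin.Permutation using (Permutation′; _⟨$⟩ʳ_)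
open import Data.Fin.Properties using (_≟_)
open import Data.Integer.Base as ℤ using (ℤ; +_; 0ℤ)
open import Data.List.Base using (allFin; filter; length)
open import Data.Nat.Base using (ℕ; NonZero)
open import Data.Nat.GeneralisedArithmetic using (iterate)
open import Data.Product.Base using (∃-syntax; _×_)
open import Function.Bundles using (_⇔_)
open import Function.Definitions using (StrictlySurjective)
open import Relation.Binary.Construct.Closure.ReflexiveTransitive using (Star)
open import Relation.Binary.PropositionalEquality.Core using (_≡_; _≢_)

SameOrbit : ∀ {n} → (Fin n → Fin n) → Fin n → Fin n → Set
SameOrbit f x y = ∃[ k ] iterate f x k ≡ y

-- For bijective f: `orbit` identifies the set of orbits of f with Fin m.
record IsOrbitMap {n m : ℕ} (f : Fin n → Fin n) (orbit : Fin n → Fin m) : Set where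
  field
    surjective : StrictlySurjective _≡_ orbit
    sameOrbit  : ∀ x y → orbit x ≡ orbit y ⇔ SameOrbit f x y

fibreSize : ∀ {n m} → (Fin n → Fin m) → Fin m → ℕ
fibreSize {n} f y = length (filter (λ x → f x ≟ y) (allFin n))

-- A map with at least one edge on a closed connected oriented surface, given
-- by its rotation system. A dart is an edge-end, equivalently an edge with a
-- direction, pointing away from the vertex at that end. The embedding is
-- determined up to orientation-preserving homeomorphism by the clockwise
-- cyclic order of the darts around each vertex, and every connected rotation
-- system arises this way.
record OrientedMap : Set where
  field
    #darts #vertices #edges #faces : ℕ
    nonEmpty : NonZero #darts

  Dart : Set
  Dart = Fin #darts

  Vertex : Set
  Vertex = Fin #vertices

  Edge : Set
  Edge = Fin #edges

  Face : Set
  Face = Fin #faces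

  field
    rotation           : Permutation′ #darts
    reverse            : Dart → Dart
    reverse-involutive : Involutive _≡_ reverse
    reverse-≢          : ∀ d → reverse d ≢ d

  -- The next dart clockwise around the vertex from which d points away.
  nextAtVertex : Dart → Dart
  nextAtVertex d = rotation ⟨$⟩ʳ d

  -- The next dart along the boundary walk of the face to the left of d: at
  -- the head of d, take the dart clockwise next to the one just arrived along.
  nextAlongFace : Dart → Dart
  nextAlongFace d = nextAtVertex (reverse d)

  field
    vertex : Dart → Vertex
    edge   : Dart → Edge
    face   : Dart → Face
    vertex-isOrbitMap : IsOrbitMap nextAtVertex vertex
    edge-isOrbitMap   : IsOrbitMap reverse edge
    face-isOrbitMap   : IsOrbitMap nextAlongFace face

  Adjacent : Vertex → Vertex → Set
  Adjacent v w = ∃[ d ] vertex d ≡ v × vertex (reverse d) ≡ w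

  field
    connected : ∀ v w → Star Adjacent v w

  degree : Vertex → ℕ
  degree = fibreSize vertex

  -- Each dart with f on its left is one step of the boundary walk of f, so an
  -- edge with f on both sides is counted twice.
  boundaryLength : Face → ℕ
  boundaryLength = fibreSize face

  eulerCharacteristic : ℤ
  eulerCharacteristic = + #vertices ℤ.- + #edges ℤ.+ + #faces

module _ (M : OrientedMap) where
  open OrientedMap M

  -- By the classification of surfaces, the torus is the only closed connected
  -- orientable surface of Euler characteristic 0.
  OnTorus : Set
  OnTorus = eulerCharacteristic ≡ 0ℤ

  IsQuadrangulation : Set
  IsQuadrangulation = ∀ f → boundaryLength f ≡ 4

  Is2,6-Quadrangulation : Set
  Is2,6-Quadrangulation =
    IsQuadrangulation ×
    (∃[ p ] ∃[ q ] degree p ≡ 2 × degree q ≡ 6 ×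
      (∀ v → v ≢ p → v ≢ q → degree v ≡ 4))

  EdgeColoring : Set
  EdgeColoring = Edge → Bool

  AlternatesAroundFaces : EdgeColoring → Set
  AlternatesAroundFaces c = ∀ d → c (edge d) ≢ c (edge (nextAlongFace d))

  AlternatesAroundVertices : EdgeColoring → Set
  AlternatesAroundVertices c = ∀ d → c (edge d) ≢ c (edge (nextAtVertex d))

module Submission where

-- Edges of one colour bound rows of quadrilaterals, and R walks along the lower
-- boundary of a row; its orbits are the boundary lines of rows. Reading a row
-- from its upper side (τ) pairs all lines of a given length. Reversing darts (ρ)
-- pairs those that avoid the vertex q of degree 6, because rotating by four darts
-- is trivial at every other vertex. No line is paired with itself, so an even
-- number of lines of each length passes q. Three darts e, s e, s (s e) of one
-- colour leave q. If all lie on one line, that line is unpaired. If e is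
-- alone on its line, of length z, then running this line backwards gives
-- R^z (s (s e)) = s e, so it is the only line through q fixed by R^z.

open import Defs
open import Algebra.Bundles using (CommutativeRing)
open import Data.Bool.Base using (Bool; true; false; not; _xor_; if_then_else_)
import Data.Bool.Properties as Bool
open import Data.Empty using (⊥)
open import Data.Fin.Base using (Fin; zero; suc; toℕ)
open import Data.Fin.Permutation using (permutation)
import Data.Fin.Properties as Fin
open import Data.List.Base using (List; _∷_; allFin; applyUpTo; filter; head; length)
open import Data.List.Membership.Propositional using (_∈_)
open import Data.List.Membership.Propositional.Properties
  using (∈-allFin; ∈-applyUpTo⁺; ∈-applyUpTo⁻; ∈-filter⁺; ∈-filter⁻)
open import Data.List.Membership.Propositional.Properties.WithK using (unique∧set⇒bag)
open import Data.List.Properties using (filter-≐; length-applyUpTo)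
open import Data.List.Relation.Binary.BagAndSetEquality using (∼bag⇒↭)
open import Data.List.Relation.Binary.Permutation.Propositional.Properties using (↭-length)
open import Data.List.Relation.Unary.Any using (here)
import Data.List.Relation.Unary.Unique.Propositional.Properties as Unique
open import Data.Maybe.Base using (fromMaybe)
open import Data.Nat.Base
  using (ℕ; zero; suc; NonZero; _+_; _*_; _∸_; _<_; _≤_; s≤s; z≤n; z<s; >-nonZero; _%_; _/_)
open import Data.Nat.DivMod using (m≡m%n+[m/n]*n; m%n<n)
open import Data.Nat.GeneralisedArithmetic using (iterate)
open import Data.Nat.Induction using (<-rec)
import Data.Nat.Properties as ℕ
open import Data.Nat.Tactic.RingSolver using (solve-∀)
open import Data.Product.Base using (∃-syntax; _×_; _,_; proj₁; proj₂)
open import Data.Sum.Base using (_⊎_; inj₁; inj₂)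
open import Data.Unit.Base using (⊤; tt)
open import Function.Base using (_∘_)
open import Function.Bundles using (_⇔_; mk⇔; Equivalence; Injection)
open import Function.Definitions using (Injective)
open import Function.Properties.Inverse using (↔⇒↣)
open import Relation.Binary.Definitions using (tri<; tri≈; tri>)
open import Relation.Binary.PropositionalEquality
open import Relation.Nullary.Decidable
  using (Dec; yes; no; does; map′; dec-true; dec-false; does-⇔; ¬?; _×-dec_)
open import Relation.Nullary.Negation.Core using (¬_; contradiction)
open import Relation.Unary using (Decidable)

open import Algebra.Properties.CommutativeMonoid.Sum
  (CommutativeRing.+-commutativeMonoid Bool.xor-∧-commutativeRing)
  using (sum; sum-cong-≗; sum-permute; ∑-distrib-+; sum-replicate-zero)

-- Iteration, reversal and minimal periods

least : {P : ℕ → Set} → Decidable P → ∀ {n} → P n → ∃[ k ] P k × (∀ {j} → j < k → ¬ P j)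
least {P} P? {n} = <-rec (λ n → P n → ∃[ k ] P k × (∀ {j} → j < k → ¬ P j)) go n
  where
  go : ∀ n → (∀ {m} → m < n → P m → ∃[ k ] P k × (∀ {j} → j < k → ¬ P j)) →
       P n → ∃[ k ] P k × (∀ {j} → j < k → ¬ P j)
  go n rec Pn with ℕ.anyUpTo? P? n
  ... | yes (m , m<n , Pm) = rec m<n Pm
  ... | no ∄m = n , Pn , λ j<n Pj → ∄m (_ , j<n , Pj)

even⊎odd : ∀ n → ∃[ j ] (n ≡ j + j ⊎ n ≡ suc (j + j))
even⊎odd zero = 0 , inj₁ refl
even⊎odd (suc n) with even⊎odd n
... | j , inj₁ refl = j , inj₂ refl
... | j , inj₂ refl = suc j , inj₁ (cong suc (sym (ℕ.+-suc j j)))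

double-odd : ∀ j m → suc (j + m) + suc (j + m) ≡ suc (m + m) + suc (j + j)
double-odd = solve-∀

double-even : ∀ j m → suc ((j + m) + (j + m)) ≡ (m + m) + suc (j + j)
double-even = solve-∀

module _ {A : Set} (f : A → A) where

  iterate-suc : ∀ x k → iterate f x (suc k) ≡ f (iterate f x k)
  iterate-suc x zero = refl
  iterate-suc x (suc k) = iterate-suc (f x) k

  iterate-+ : ∀ x j k → iterate f x (j + k) ≡ iterate f (iterate f x j) k
  iterate-+ x zero k = refl
  iterate-+ x (suc j) k = iterate-+ (f x) j k

  iterate-* : ∀ {x k} m → iterate f x k ≡ x → iterate f x (m * k) ≡ x
  iterate-* zero eq = refl
  iterate-* {x} {k} (suc m) eq = begin
    iterate f x (k + m * k)            ≡⟨ iterate-+ x k (m * k) ⟩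
    iterate f (iterate f x k) (m * k)  ≡⟨ cong (λ y → iterate f y (m * k)) eq ⟩
    iterate f x (m * k)                ≡⟨ iterate-* m eq ⟩
    x                                  ∎
    where open ≡-Reasoning

  iterate-injective : Injective _≡_ _≡_ f → ∀ k {x y} → iterate f x k ≡ iterate f y k → x ≡ y
  iterate-injective inj zero eq = eq
  iterate-injective inj (suc k) eq = inj (iterate-injective inj k eq)

  iterate-closed : {P : A → Set} → (∀ {x} → P x → P (f x)) → ∀ k {x} → P x → P (iterate f x k)
  iterate-closed closed zero Px = Px
  iterate-closed {P} closed (suc k) Px = iterate-closed {P} closed k (closed Px)

  -- On `P` the map `t` turns a step of `f` into a step backwards, so `k` steps from the image of
  -- the end point lead to the image of the start. `P` is there because reversing darts turns lines
  -- around only away from `q`.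
  iterate-reverse : {P : A → Set} {t : A → A} → (∀ {x} → P x → P (f x)) →
                    (∀ {x} → P x → f (t (f x)) ≡ t x) →
                    ∀ k {x} → P x → iterate f (t (iterate f x k)) k ≡ t x
  iterate-reverse closed rev zero Px = refl
  iterate-reverse {P} {t} closed rev (suc k) {x} Px = begin
    iterate f (t (iterate f (f x) k)) (suc k)  ≡⟨ iterate-suc _ k ⟩
    f (iterate f (t (iterate f (f x) k)) k)    ≡⟨ cong f (iterate-reverse {P} closed rev k (closed Px)) ⟩
    f (t (f x))                                ≡⟨ rev Px ⟩
    t x                                        ∎
    where open ≡-Reasoning

record MinimalPeriod {A : Set} (f : A → A) (x : A) (k : ℕ) : Set where
  field
    positive : 0 < k
    periodic : iterate f x k ≡ x
    minimal  : ∀ {j} → j < k → iterate f x j ≡ x → j ≡ 0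

open MinimalPeriod

iterate-% : ∀ {A : Set} {f : A → A} {x N} → MinimalPeriod f x N → .{{_ : NonZero N}} →
            ∀ k → iterate f x (k % N) ≡ iterate f x k
iterate-% {f = f} {x} {N} per k = begin
  iterate f x (k % N)                          ≡⟨ cong (λ z → iterate f z (k % N)) (iterate-* f (k / N) (periodic per)) ⟨
  iterate f (iterate f x (k / N * N)) (k % N)  ≡⟨ iterate-+ f x (k / N * N) (k % N) ⟨
  iterate f x (k / N * N + k % N)              ≡⟨ cong (iterate f x) (ℕ.+-comm (k / N * N) (k % N)) ⟩
  iterate f x (k % N + k / N * N)              ≡⟨ cong (iterate f x) (m≡m%n+[m/n]*n k N) ⟨
  iterate f x k                                ∎
  where open ≡-Reasoning

-- Parity of a count as an xor-sum of indicators

does-xor : {D A B : Set} (D? : Dec D) (A? : Dec A) (B? : Dec B) →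
           (D → A) → (D → ¬ B) → (¬ D → A ⇔ B) → does A? ≡ does D? xor does B?
does-xor (yes d) A? B? D⇒A D⇒¬B _ =
  trans (dec-true A? (D⇒A d)) (sym (cong not (dec-false B? (D⇒¬B d))))
does-xor (no ¬d) A? B? _ _ A⇔B = does-⇔ (A⇔B ¬d) A? B?

-- Pairing x with g x, exactly one of x < g x and g x < g (g x) holds at each x of P.
involution-parity : ∀ {n} {P : Fin n → Set} (P? : Decidable P) (g : Fin n → Fin n) →
                    (∀ {x} → P x → P (g x)) → (∀ {x} → P x → g (g x) ≡ x) →
                    (∀ {x} → P x → g x ≢ x) →
                    sum (λ x → does (P? x)) ≡ false
involution-parity {n} {P} P? g closed involutive moves = begin
  sum (λ x → does (P? x))                 ≡⟨ sum-cong-≗ split ⟩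
  sum (λ x → rises x xor rises (h x))     ≡⟨ ∑-distrib-+ rises (rises ∘ h) ⟩
  sum rises xor sum (rises ∘ h)           ≡⟨ cong (sum rises xor_) (sum-permute rises π) ⟨
  sum rises xor sum rises                 ≡⟨ Bool.xor-same (sum rises) ⟩
  false                                   ∎
  where
  open ≡-Reasoning
  -- Extended by the identity, `g` becomes a permutation of all of `Fin n`, so the second sum may be
  -- reindexed; off `P` the two terms of `split` cancel.
  h : Fin n → Fin n
  h x = if does (P? x) then g x else x
  h-in : ∀ {x} → P x → h x ≡ g x
  h-in {x} Px rewrite dec-true (P? x) Px = refl
  h-out : ∀ {x} → ¬ P x → h x ≡ x
  h-out {x} ¬Px rewrite dec-false (P? x) ¬Px = refl
  h-involutive : ∀ x → h (h x) ≡ x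
  h-involutive x with P? x
  ... | yes Px = trans (h-in (closed Px)) (involutive Px)
  ... | no ¬Px = h-out ¬Px
  π = permutation h h h-involutive h-involutive
  rises : Fin n → Bool
  rises x = does (x Fin.<? h x)
  split : ∀ x → does (P? x) ≡ rises x xor rises (h x)
  split x rewrite h-involutive x with P? x
  ... | no ¬Px = sym (Bool.xor-same (does (x Fin.<? x)))
  ... | yes Px with Fin.<-cmp x (g x)
  ... | tri< x<gx _ ¬gx<x rewrite dec-true (x Fin.<? g x) x<gx | dec-false (g x Fin.<? x) ¬gx<x = refl
  ... | tri≈ _ x≡gx _ = contradiction (sym x≡gx) (moves Px)
  ... | tri> ¬x<gx _ gx<x rewrite dec-false (x Fin.<? g x) ¬x<gx | dec-true (g x Fin.<? x) gx<x = refl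

sum-indicator : ∀ {n} (r : Fin n) → sum (λ x → does (x Fin.≟ r)) ≡ true
sum-indicator {suc n} zero = cong not (sum-replicate-zero n)
sum-indicator (suc r) = sum-indicator r

-- Orbits of an injective map, and involutions that reverse them

module Orbits {n} (f : Fin n → Fin n) (f-injective : Injective _≡_ _≡_ f) where

  _~_ : Fin n → Fin n → Set
  _~_ = SameOrbit f

  iterate-cancel : ∀ {x i j} → i ≤ j → iterate f x i ≡ iterate f x j → iterate f x (j ∸ i) ≡ x
  iterate-cancel {x} {i} {j} i≤j eq = iterate-injective f f-injective i (begin
    iterate f (iterate f x (j ∸ i)) i  ≡⟨ iterate-+ f x (j ∸ i) i ⟨
    iterate f x (j ∸ i + i)            ≡⟨ cong (iterate f x) (ℕ.m∸n+n≡m i≤j) ⟩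
    iterate f x j                      ≡⟨ eq ⟨
    iterate f x i                      ∎)
    where open ≡-Reasoning

  -- Among `n + 1` iterates two coincide, and injectivity cancels the common initial steps to give a
  -- return to `x` itself.
  minimalPeriod : ∀ x → ∃[ k ] MinimalPeriod f x k
  minimalPeriod x
    with i , j , i<j , eq ← Fin.pigeonhole (ℕ.n<1+n n) (λ i → iterate f x (toℕ i))
    with k , (0<k , eq) , least-k ← least (λ k → 0 ℕ.<? k ×-dec (iterate f x k Fin.≟ x))
           (ℕ.m<n⇒0<n∸m i<j , iterate-cancel (ℕ.<⇒≤ i<j) eq)
    = k , record { positive = 0<k ; periodic = eq ; minimal = minimal′ least-k }
    where
    minimal′ : ∀ {k} → (∀ {j} → j < k → ¬ (0 < j × iterate f x j ≡ x)) →
               ∀ {j} → j < k → iterate f x j ≡ x → j ≡ 0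
    minimal′ least-k {zero} j<k eq = refl
    minimal′ least-k {suc j} j<k eq = contradiction (z<s , eq) (least-k j<k)

  ~-refl : ∀ {x} → x ~ x
  ~-refl = 0 , refl

  ~-trans : ∀ {x y z} → x ~ y → y ~ z → x ~ z
  ~-trans {x} (j , refl) (k , refl) = j + k , iterate-+ f x j k

  -- Iterating `f` until one step short of a full period inverts it. Reachability by forward steps
  -- is therefore symmetric.
  predecessor : ∀ x → ∃[ y ] f y ≡ x × x ~ y
  predecessor x with minimalPeriod x
  ... | suc k , per = iterate f x k , trans (sym (iterate-suc f x k)) (periodic per) , k , refl
  ... | zero , per = contradiction (positive per) λ ()

  f~ : ∀ x → f x ~ x
  f~ x with y , fy≡x , k , eq ← predecessor (f x) = k , trans eq (f-injective fy≡x)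

  ~-sym : ∀ {x y} → x ~ y → y ~ x
  ~-sym (zero , refl) = ~-refl
  ~-sym {x} (suc k , eq) = ~-trans (~-sym (k , eq)) (f~ x)

  infix 4 _~?_
  -- A bounded search suffices, because exponents matter only modulo the period of `x`.
  _~?_ : ∀ x y → Dec (x ~ y)
  x ~? y with minimalPeriod x
  ... | N , per = map′ (λ (k , _ , eq) → k , eq) reduce
                       (ℕ.anyUpTo? (λ k → iterate f x k Fin.≟ y) N)
    where
    instance N≢0 = >-nonZero (positive per)
    reduce : x ~ y → ∃[ k ] k < N × iterate f x k ≡ y
    reduce (k , eq) = k % N , m%n<n k N , trans (iterate-% per k) eq

  orbitList : Fin n → List (Fin n)
  orbitList x = filter (x ~?_) (allFin n)

  -- Points of one orbit filter out the same list, so its head is a canonical choice, and orbits are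
  -- counted as fixed points of this map. The default never occurs: `x` is in its own orbit list.
  representative : Fin n → Fin n
  representative x = fromMaybe x (head (orbitList x))

  ∈-orbitList : ∀ {x y} → x ~ y → y ∈ orbitList x
  ∈-orbitList {x} x~y = ∈-filter⁺ (x ~?_) (∈-allFin _) x~y

  representative~ : ∀ x → x ~ representative x
  representative~ x = proj₂ (∈-filter⁻ (x ~?_) {xs = allFin n} (head-∈ (∈-orbitList ~-refl)))
    where
    head-∈ : ∀ {y} {xs : List (Fin n)} → y ∈ xs → fromMaybe x (head xs) ∈ xs
    head-∈ {xs = _ ∷ _} _ = here refl

  representative-cong : ∀ {x y} → x ~ y → representative x ≡ representative y
  representative-cong {x} {y} x~y = trans
    (head-irrelevant (∈-orbitList ~-refl))
    (cong (fromMaybe y ∘ head)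
      (filter-≐ (x ~?_) (y ~?_) (~-trans (~-sym x~y) , ~-trans x~y) (allFin n)))
    where
    head-irrelevant : ∀ {z} {xs : List (Fin n)} → z ∈ xs → fromMaybe x (head xs) ≡ fromMaybe y (head xs)
    head-irrelevant {xs = _ ∷ _} _ = refl

  -- One period of the walk from `x` lists the fibre without repetition, so the lengths agree. This
  -- turns degrees and boundary lengths into periods.
  fibreSize⇒minimalPeriod : ∀ {m} {orbit : Fin n → Fin m} → IsOrbitMap f orbit →
                            ∀ {k} x → fibreSize orbit (orbit x) ≡ k → MinimalPeriod f x k
  fibreSize⇒minimalPeriod {orbit = orbit} isOrbitMap x refl with minimalPeriod x
  ... | N , per = subst (MinimalPeriod f x) (sym size≡N) per
    where
    instance N≢0 = >-nonZero (positive per)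
    distinct : ∀ {i j} → i < j → j < N → iterate f x i ≢ iterate f x j
    distinct {i} {j} i<j j<N eq = ℕ.<⇒≢ (ℕ.m<n⇒0<n∸m i<j)
      (sym (minimal per (ℕ.≤-<-trans (ℕ.m∸n≤m j i) j<N) (iterate-cancel (ℕ.<⇒≤ i<j) eq)))
    inFibre? : Decidable (λ y → orbit y ≡ orbit x)
    inFibre? y = orbit y Fin.≟ orbit x
    fibre = filter inFibre? (allFin n)
    walk = applyUpTo (iterate f x) N
    sameOrbit = IsOrbitMap.sameOrbit isOrbitMap
    fibre⊆walk : ∀ {y} → y ∈ fibre → y ∈ walk
    fibre⊆walk {y} y∈ with Equivalence.to (sameOrbit x y) (sym (proj₂ (∈-filter⁻ inFibre? {xs = allFin n} y∈)))
    ... | k , refl = subst (_∈ walk) (iterate-% per k) (∈-applyUpTo⁺ (iterate f x) (m%n<n k N))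
    walk⊆fibre : ∀ {y} → y ∈ walk → y ∈ fibre
    walk⊆fibre y∈ with k , _ , refl ← ∈-applyUpTo⁻ (iterate f x) y∈ =
      ∈-filter⁺ _ (∈-allFin _) (sym (Equivalence.from (sameOrbit x _) (k , refl)))
    size≡N : length fibre ≡ N
    size≡N = trans
      (↭-length (∼bag⇒↭ (unique∧set⇒bag
        (Unique.filter⁺ _ (Unique.allFin⁺ n))
        (Unique.applyUpTo⁺₁ _ N distinct)
        (mk⇔ fibre⊆walk walk⊆fibre))))
      (length-applyUpTo (iterate f x) N)

  -- On `P` the involution `t` conjugates `f` to its inverse. A solution of `f x ≡ t x` is a turn, a
  -- step whose two ends `t` swaps. An orbit carried to itself without fixed points would need two
  -- turns, and `turn-unique` permits only one.
  record Reverses (P : Fin n → Set) (t : Fin n → Fin n) : Set where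
    field
      closed-f    : ∀ {x} → P x → P (f x)
      closed-t    : ∀ {x} → P x → P (t x)
      involutive  : ∀ x → t (t x) ≡ x
      reverses    : ∀ {x} → P x → f (t (f x)) ≡ t x
      t-≢         : ∀ x → t x ≢ x
      turn-unique : ∀ {x y} → P x → P y → f x ≡ t x → f y ≡ t y → x ≡ y

    closed-~ : ∀ {x y} → x ~ y → P x → P y
    closed-~ (k , refl) = iterate-closed f {P} closed-f k

    -- Otherwise `t` would fix the midpoint of the way from `x` to `t x`.
    no-even : ∀ {x} → P x → ∀ j → iterate f x (j + j) ≢ t x
    no-even {x} Px j eq = t-≢ (iterate f x j) (sym (iterate-injective f f-injective j (begin
      iterate f (iterate f x j) j      ≡⟨ iterate-+ f x j j ⟨
      iterate f x (j + j)              ≡⟨ eq ⟩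
      t x                              ≡⟨ iterate-reverse f {P} closed-f reverses j Px ⟨
      iterate f (t (iterate f x j)) j  ∎)))
      where open ≡-Reasoning

    -- A way of odd length has a middle step instead of a midpoint, and `t` swaps the ends of that
    -- step.
    odd⇒turn : ∀ {x} → P x → ∀ j → iterate f x (suc (j + j)) ≡ t x →
               f (iterate f x j) ≡ t (iterate f x j)
    odd⇒turn {x} Px j eq = iterate-injective f f-injective j (begin
      iterate f (iterate f x j) (suc j)  ≡⟨ iterate-+ f x j (suc j) ⟨
      iterate f x (j + suc j)            ≡⟨ cong (iterate f x) (ℕ.+-suc j j) ⟩
      iterate f x (suc (j + j))          ≡⟨ eq ⟩
      t x                                ≡⟨ iterate-reverse f {P} closed-f reverses j Px ⟨
      iterate f (t (iterate f x j)) j    ∎)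
      where open ≡-Reasoning

    -- A reflection of a cyclically ordered orbit fixes an element or, if not,
    -- flips two antipodal steps.
    ¬self-reversed : ∀ {x} → P x → ¬ (x ~ t x)
    ¬self-reversed {x} Px (k , eq) with even⊎odd k
    ... | j , inj₁ refl = no-even Px j eq
    ... | j , inj₂ refl with minimalPeriod x
    ... | N , per with even⊎odd N
    -- An extra lap of odd length `N` makes the way from `x` to `t x` even.
    ... | m , inj₂ refl = no-even Px (suc (j + m)) (trans (cong (iterate f x) (double-odd j m)) shifted)
      where
      shifted : iterate f x (suc (m + m) + suc (j + j)) ≡ t x
      shifted = trans (iterate-+ f x (suc (m + m)) (suc (j + j)))
                      (trans (cong (λ y → iterate f y (suc (j + j))) (periodic per)) eq)
    -- For even `N` an extra lap gives a second turn, `m` steps after the first. Uniqueness makes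
    -- `m` steps a return to `x`, although `m` is below the period `m + m`.
    ... | m , inj₁ refl = contradiction (subst (λ m → 0 < m + m) m≡0 (positive per)) λ ()
      where
      shifted : iterate f x (suc ((j + m) + (j + m))) ≡ t x
      shifted = trans (cong (iterate f x) (double-even j m)) (trans (iterate-+ f x (m + m) (suc (j + j)))
                      (trans (cong (λ y → iterate f y (suc (j + j))) (periodic per)) eq))
      0<m : 0 < m
      0<m = ℕ.n≢0⇒n>0 λ { refl → contradiction (positive per) λ () }
      same : iterate f x j ≡ iterate f x (j + m)
      same = turn-unique (iterate-closed f {P} closed-f j Px) (iterate-closed f {P} closed-f (j + m) Px)
                         (odd⇒turn Px j eq) (odd⇒turn Px (j + m) shifted)
      m≡0 : m ≡ 0
      m≡0 = minimal per (ℕ.m<m+n m 0<m)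
        (trans (cong (iterate f x) (sym (ℕ.m+n∸m≡n j m))) (iterate-cancel (ℕ.m≤m+n j m) same))

    t-cong : ∀ {x y} → P x → x ~ y → t x ~ t y
    t-cong Px (k , refl) = ~-sym (k , iterate-reverse f {P} closed-f reverses k Px)

    -- `t` acts on the orbits in `P` as an involution and, by `¬self-reversed`, keeps none.
    -- Composing with `representative` transfers this pairing to one point per orbit.
    even-orbits : (P? : Decidable P) →
                  sum (λ x → does (P? x ×-dec (representative x Fin.≟ x))) ≡ false
    even-orbits P? = involution-parity
      (λ x → P? x ×-dec (representative x Fin.≟ x)) (representative ∘ t)
      (λ {x} (Px , _) → closed-~ (representative~ (t x)) (closed-t Px)
                      , sym (representative-cong (representative~ (t x))))
      (λ {x} (Px , rx) → trans
        (sym (representative-cong (~-trans (subst (_~ t (t x)) (involutive x) ~-refl)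
                                           (t-cong (closed-t Px) (representative~ (t x)))))) rx)
      (λ {x} (Px , _) eq → ¬self-reversed Px (~-sym (subst (t x ~_) eq (representative~ (t x)))))

-- Alternation around faces and around vertices

alternate² : ∀ {a b c : Bool} → a ≢ b → b ≢ c → c ≡ a
alternate² a≢b b≢c = sym (trans (Bool.¬-not a≢b) (sym (Bool.¬-not (b≢c ∘ sym))))

module _ (M : OrientedMap) where
  open OrientedMap M

  edge-reverse : ∀ d → edge (reverse d) ≡ edge d
  edge-reverse d = sym (Equivalence.from (IsOrbitMap.sameOrbit edge-isOrbitMap d (reverse d)) (1 , refl))

  -- Since `nextAlongFace` is `nextAtVertex` after `reverse`, and reversing keeps the edge, either
  -- condition at `d` is the other one at `reverse d`.
  alternation-⇔ : ∀ c → AlternatesAroundFaces M c ⇔ AlternatesAroundVertices M c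
  alternation-⇔ c = mk⇔
    (λ alt d → subst₂ (λ e d′ → c e ≢ c (edge (nextAtVertex d′)))
                      (edge-reverse d) (reverse-involutive d) (alt (reverse d)))
    (λ alt d → subst (λ e → c e ≢ c (edge (nextAlongFace d))) (edge-reverse d) (alt (reverse d)))

-- Rotations and lines in a two-coloured quadrangulation

module Bicoloured
  (M : OrientedMap) (quadrilateral : IsQuadrangulation M)
  (p q : OrientedMap.Vertex M)
  (degree-p : OrientedMap.degree M p ≡ 2) (degree-q : OrientedMap.degree M q ≡ 6)
  (degree-else : ∀ v → v ≢ p → v ≢ q → OrientedMap.degree M v ≡ 4)
  (c : EdgeColoring M) (alternates : AlternatesAroundFaces M c)
  where

  open OrientedMap M
  open ≡-Reasoning

  colour : Dart → Bool
  colour d = c (edge d)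

  σ ρ φ : Dart → Dart
  σ = nextAtVertex
  ρ = reverse
  φ = nextAlongFace

  ρρ = reverse-involutive

  σ-injective : Injective _≡_ _≡_ σ
  σ-injective = Injection.injective (↔⇒↣ rotation)

  ρ-injective : Injective _≡_ _≡_ ρ
  ρ-injective eq = trans (sym (ρρ _)) (trans (cong ρ eq) (ρρ _))

  -- R crosses a vertex without changing the colour class: on the edges of one
  -- colour it walks along the lower boundary of a row of quadrilaterals.
  s R τ : Dart → Dart
  s d = σ (σ d)
  R d = s (ρ d)
  τ d = φ (φ d)

  R-injective : Injective _≡_ _≡_ R
  R-injective = ρ-injective ∘ σ-injective ∘ σ-injective

  open Orbits R R-injective

  colour-σ : ∀ d → colour d ≢ colour (σ d)
  colour-σ = Equivalence.to (alternation-⇔ M c) alternates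

  colour-s : ∀ d → colour (s d) ≡ colour d
  colour-s d = alternate² (colour-σ d) (colour-σ (σ d))

  colour-ρ : ∀ d → colour (ρ d) ≡ colour d
  colour-ρ d = cong c (edge-reverse M d)

  colour-R : ∀ d → colour (R d) ≡ colour d
  colour-R d = trans (colour-s (ρ d)) (colour-ρ d)

  colour-τ : ∀ d → colour (τ d) ≡ colour d
  colour-τ d = alternate² (alternates d) (alternates (φ d))

  vertex-period : ∀ {k} d → degree (vertex d) ≡ k → MinimalPeriod σ d k
  vertex-period = Orbits.fibreSize⇒minimalPeriod σ σ-injective vertex-isOrbitMap

  face-period : ∀ d → MinimalPeriod φ d 4
  face-period d = Orbits.fibreSize⇒minimalPeriod φ (ρ-injective ∘ σ-injective) face-isOrbitMap d
    (quadrilateral (face d))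

  vertex-σ : ∀ d → vertex (σ d) ≡ vertex d
  vertex-σ d = sym (Equivalence.from (IsOrbitMap.sameOrbit vertex-isOrbitMap d (σ d)) (1 , refl))

  vertex-s : ∀ d → vertex (s d) ≡ vertex d
  vertex-s d = trans (vertex-σ (σ d)) (vertex-σ d)

  s-moves : ∀ {k} d → 2 < k → degree (vertex d) ≡ k → s d ≢ d
  s-moves d 2<k eq sd≡d = contradiction (minimal (vertex-period d eq) {2} 2<k sd≡d) λ ()

  q⇒s-≢ : ∀ d → vertex d ≡ q → s d ≢ d
  q⇒s-≢ d v≡q = s-moves d (s≤s (s≤s (s≤s z≤n))) (trans (cong degree v≡q) degree-q)

  s-fixed⇒p : ∀ d → s d ≡ d → vertex d ≡ p
  s-fixed⇒p d sd≡d with vertex d Fin.≟ p | vertex d Fin.≟ q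
  ... | yes v≡p | _ = v≡p
  ... | no _ | yes v≡q = contradiction sd≡d (q⇒s-≢ d v≡q)
  ... | no v≢p | no v≢q = contradiction sd≡d
    (s-moves d (s≤s (s≤s (s≤s z≤n))) (degree-else (vertex d) v≢p v≢q))

  p⇒s-fixed : ∀ d → vertex d ≡ p → s d ≡ d
  p⇒s-fixed d v≡p = periodic (vertex-period d (trans (cong degree v≡p) degree-p))

  ¬q⇒s²-fixed : ∀ d → vertex d ≢ q → s (s d) ≡ d
  ¬q⇒s²-fixed d v≢q with vertex d Fin.≟ p
  ... | yes v≡p = trans (cong s (p⇒s-fixed d v≡p)) (p⇒s-fixed d v≡p)
  ... | no v≢p = periodic (vertex-period d (degree-else (vertex d) v≢p v≢q))

  q⇒s³-fixed : ∀ d → vertex d ≡ q → s (s (s d)) ≡ d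
  q⇒s³-fixed d v≡q = periodic (vertex-period d (trans (cong degree v≡q) degree-q))

  -- Colours alternate under `σ`, so darts of one colour at a vertex differ by an even rotation, a
  -- power of `s`.
  s-orbit : ∀ {x y} → vertex x ≡ vertex y → colour x ≡ colour y → SameOrbit s x y
  s-orbit {x} {y} same-vertex = go (proj₁ orbit) x (proj₂ orbit)
    where
    orbit = Equivalence.to (IsOrbitMap.sameOrbit vertex-isOrbitMap x y) same-vertex
    go : ∀ k x → iterate σ x k ≡ y → colour x ≡ colour y → SameOrbit s x y
    go zero x eq _ = 0 , eq
    go (suc zero) x refl same = contradiction same (colour-σ x)
    go (suc (suc k)) x eq same with j , eq′ ← go k (s x) eq (trans (colour-s x) same) = suc j , eq′

  unique-at-p : ∀ {x y} → vertex x ≡ p → vertex y ≡ p → colour x ≡ colour y → x ≡ y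
  unique-at-p {x} vx vy same with k , eq ← s-orbit (trans vx (sym vy)) same =
    trans (sym (iterate-closed s {_≡ x} (λ { refl → p⇒s-fixed x vx }) k refl)) eq

  three-at-q : ∀ {x y} → vertex x ≡ q → vertex y ≡ q → colour x ≡ colour y →
               y ≡ x ⊎ y ≡ s x ⊎ y ≡ s (s x)
  three-at-q {x} vx vy same with k , refl ← s-orbit (trans vx (sym vy)) same =
    iterate-closed s {λ y → y ≡ x ⊎ y ≡ s x ⊎ y ≡ s (s x)}
      (λ { (inj₁ refl) → inj₂ (inj₁ refl)
         ; (inj₂ (inj₁ refl)) → inj₂ (inj₂ refl)
         ; (inj₂ (inj₂ refl)) → inj₁ (q⇒s³-fixed x vx) })
      k (inj₁ refl)

  -- With `R` written as `φ ∘ ρ ∘ φ`, four consecutive `φ` meet in the middle. They go once round a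
  -- quadrilateral, and the remaining two `ρ` cancel.
  R-τ-R : ∀ d → R (τ (R d)) ≡ τ d
  R-τ-R d = begin
    R (τ (R d))                ≡⟨ R-φρφ (τ (R d)) ⟩
    φ (ρ (φ (τ (R d))))        ≡⟨ cong (λ x → φ (ρ (φ (τ x)))) (R-φρφ d) ⟩
    φ (ρ (φ (τ (φ (ρ (φ d))))))  ≡⟨ cong (φ ∘ ρ) (periodic (face-period (ρ (φ d)))) ⟩
    φ (ρ (ρ (φ d)))            ≡⟨ cong φ (ρρ (φ d)) ⟩
    τ d                        ∎
    where
    R-φρφ : ∀ d → R d ≡ φ (ρ (φ d))
    R-φρφ d = cong σ (sym (ρρ (σ (ρ d))))

  τ-≢ : ∀ d → τ d ≢ d
  τ-≢ d eq = contradiction (minimal (face-period d) {2} (s≤s (s≤s (s≤s z≤n))) eq) λ ()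

  -- The two sides are `σ` applied to `φ d` and to its reverse. Hence `τ` admits no turns.
  R≢τ : ∀ d → R d ≢ τ d
  R≢τ d eq = reverse-≢ (φ d) (sym (σ-injective eq))

  -- Lines through `q` and the parity argument

  Touches : Dart → Set
  Touches d = ∃[ x ] d ~ x × vertex x ≡ q

  touches? : Decidable Touches
  touches? d = Fin.any? (λ x → d ~? x ×-dec (vertex x Fin.≟ q))

  touches-~ : ∀ {x y} → x ~ y → Touches y → Touches x
  touches-~ x~y (z , y~z , vz) = z , ~-trans x~y y~z , vz

  ¬touches-R : ∀ {d} → ¬ Touches d → ¬ Touches (R d)
  ¬touches-R ¬t = ¬t ∘ touches-~ (1 , refl)

  -- Away from q, R = s⁻¹ ∘ ρ, which ρ conjugates to R⁻¹.
  R-ρ-R : ∀ d → vertex (R d) ≢ q → R (ρ (R d)) ≡ ρ d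
  R-ρ-R d v≢q = trans (cong s (ρρ (R d)))
    (¬q⇒s²-fixed (ρ d) (v≢q ∘ trans (vertex-s (ρ d))))

  ¬touches⇒R-ρ-R : ∀ {d} → ¬ Touches d → R (ρ (R d)) ≡ ρ d
  ¬touches⇒R-ρ-R {d} ¬t = R-ρ-R d (λ v≡q → ¬t (R d , (1 , refl) , v≡q))

  -- Walking forward from `ρ d` reads the line of `d` backwards, one predecessor at a time.
  ¬touches-ρ : ∀ {d} → ¬ Touches d → ¬ Touches (ρ d)
  ¬touches-ρ ¬t (y , (k , eq) , vy) = go k ¬t eq
    where
    go : ∀ k {d} → ¬ Touches d → iterate R (ρ d) k ≢ y
    -- Here `ρ d` leaves `q`; so does `R d`, obtained from it by rotation, and `R d` is on the line
    -- of `d`.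
    go zero {d} ¬t refl = ¬t (R d , (1 , refl) , trans (vertex-s (ρ d)) vy)
    go (suc k) {d} ¬t eq with predecessor d
    ... | d′ , refl , d~d′ = go k ¬t′ (trans (cong (λ x → iterate R x k) (sym (¬touches⇒R-ρ-R ¬t′))) eq)
      where ¬t′ = ¬t ∘ touches-~ d~d′

  -- `S` selects the lines to be counted: all of them, or those whose length divides a given number.
  -- Closure under `ρ` is asked only for lines that avoid `q`, as only these are known to be
  -- reversed by it.
  module _ {S : Dart → Set} (S? : Decidable S)
    (S-R : ∀ {d} → S d → S (R d)) (S-τ : ∀ {d} → S d → S (τ d))
    (S-ρ : ∀ {d} → S d → ¬ Touches d → S (ρ d))
    {e : Dart} (vertex-e : vertex e ≡ q) (S-e : S e)
    (single : ∀ {d} → S d → colour d ≡ colour e → vertex d ≡ q → e ~ d)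
    where

    A B : Dart → Set
    A d = S d × colour d ≡ colour e
    B d = A d × ¬ Touches d

    A? : Decidable A
    A? d = S? d ×-dec (colour d Bool.≟ colour e)

    B? : Decidable B
    B? d = A? d ×-dec ¬? (touches? d)

    A-τ : Reverses A τ
    A-τ = record
      { closed-f = λ (Sd , cd) → S-R Sd , trans (colour-R _) cd
      ; closed-t = λ (Sd , cd) → S-τ Sd , trans (colour-τ _) cd
      ; involutive = λ d → periodic (face-period d)
      ; reverses = λ _ → R-τ-R _
      ; t-≢ = τ-≢
      ; turn-unique = λ _ _ turn → contradiction turn (R≢τ _)
      }

    B-ρ : Reverses B ρ
    B-ρ = record
      { closed-f = λ ((Sd , cd) , ¬t) → (S-R Sd , trans (colour-R _) cd) , ¬touches-R ¬t
      ; closed-t = λ ((Sd , cd) , ¬t) → (S-ρ Sd ¬t , trans (colour-ρ _) cd) , ¬touches-ρ ¬t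
      ; involutive = ρρ
      ; reverses = λ (_ , ¬t) → ¬touches⇒R-ρ-R ¬t
      ; t-≢ = reverse-≢
      -- At a turn `s` fixes `ρ x`, which therefore leaves `p`, where each colour has just one dart.
      ; turn-unique = λ {x} {y} ((_ , cx) , _) ((_ , cy) , _) tx ty →
          ρ-injective (unique-at-p (s-fixed⇒p (ρ x) tx) (s-fixed⇒p (ρ y) ty)
            (trans (colour-ρ x) (trans cx (sym (trans (colour-ρ y) cy)))))
      }

    isRep? : ∀ d → Dec (representative d ≡ d)
    isRep? d = representative d Fin.≟ d

    r : Dart
    r = representative e

    e~r : e ~ r
    e~r = representative~ e

    touching-rep : ∀ {d} → A d → representative d ≡ d → Touches d → d ≡ r
    touching-rep Ad rep (x , d~x , vx) =
      let Sx , cx = Reverses.closed-~ A-τ d~x Ad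
      in trans (sym rep) (representative-cong (~-trans d~x (~-sym (single Sx cx vx))))

    -- By `single`, the lines in `A` are those in `B` and the line of `e`, whose representative is
    -- `r`.
    split : ∀ d → does (A? d ×-dec isRep? d) ≡ does (d Fin.≟ r) xor does (B? d ×-dec isRep? d)
    split d = does-xor (d Fin.≟ r) (A? d ×-dec isRep? d) (B? d ×-dec isRep? d)
      (λ { refl → Reverses.closed-~ A-τ e~r (S-e , refl) , sym (representative-cong e~r) })
      (λ { refl ((_ , ¬t) , _) → ¬t (e , ~-sym e~r , vertex-e) })
      (λ d≢r → mk⇔ (λ (Ad , rep) → (Ad , d≢r ∘ touching-rep Ad rep) , rep)
                   (λ ((Ad , _) , rep) → Ad , rep))

    -- `τ` makes the number of lines in `A` even and `ρ` the number in `B`, yet these numbers differ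
    -- by one.
    single-orbit-⊥ : ⊥
    single-orbit-⊥ = contradiction (begin
      true
        ≡⟨ cong₂ _xor_ (sum-indicator r) (Reverses.even-orbits B-ρ B?) ⟨
      sum (λ d → does (d Fin.≟ r)) xor sum (λ d → does (B? d ×-dec isRep? d))
        ≡⟨ ∑-distrib-+ (λ d → does (d Fin.≟ r)) (λ d → does (B? d ×-dec isRep? d)) ⟨
      sum (λ d → does (d Fin.≟ r) xor does (B? d ×-dec isRep? d))
        ≡⟨ sum-cong-≗ split ⟨
      sum (λ d → does (A? d ×-dec isRep? d))
        ≡⟨ Reverses.even-orbits A-τ A? ⟩
      false ∎) λ ()

  -- Take `S` to be the darts fixed by `z` steps of `R`, where `z` is the length of the line of `e`.
  -- Both `τ` and, off `q`, `ρ` reverse `R` and so preserve `S`.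
  isolated-⊥ : ∀ {e} → vertex e ≡ q → ¬ (e ~ s e) → ¬ (e ~ s (s e)) → ⊥
  isolated-⊥ {e} ve e≁se e≁sse with minimalPeriod e
  ... | zero , per = contradiction (positive per) λ ()
  ... | suc k , per = single-orbit-⊥ (λ d → iterate R d z Fin.≟ d)
      (λ {d} eq → trans (iterate-suc R d z) (cong R eq))
      (λ {d} eq → trans (cong (λ x → iterate R (τ x) z) (sym eq))
                        (iterate-reverse R {λ _ → ⊤} {τ} (λ _ → tt) (λ {x} _ → R-τ-R x) z {d} tt))
      (λ {d} eq ¬t → trans (cong (λ x → iterate R (ρ x) z) (sym eq))
                           (iterate-reverse R {¬_ ∘ Touches} {ρ} ¬touches-R ¬touches⇒R-ρ-R z {d} ¬t))
      ve (periodic per) single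
    where
    z = suc k

    -- A dart of this line leaving `q` has the colour of `e`, so it is `e`, `s e` or `s (s e)`.
    -- Minimality of `z` excludes the first, isolation the others.
    avoids-q : ∀ {j} → 0 < j → j < z → vertex (iterate R e j) ≢ q
    avoids-q {j} 0<j j<z vj with three-at-q ve vj
      (sym (iterate-closed R {λ d → colour d ≡ colour e} (trans (colour-R _)) j refl))
    ... | inj₁ eq = ℕ.<⇒≢ 0<j (sym (minimal per j<z eq))
    ... | inj₂ (inj₁ eq) = e≁se (j , eq)
    ... | inj₂ (inj₂ eq) = e≁sse (j , eq)

    backwards : ∀ j → j < z → iterate R (ρ (iterate R e j)) j ≡ ρ e
    backwards zero _ = refl
    backwards (suc j) j<z = begin
      iterate R (R (ρ (iterate R e (suc j)))) j
        ≡⟨ cong (λ x → iterate R (R (ρ x)) j) (iterate-suc R e j) ⟩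
      iterate R (R (ρ (R (iterate R e j)))) j
        ≡⟨ cong (λ x → iterate R x j)
             (R-ρ-R (iterate R e j) (avoids-q z<s j<z ∘ trans (cong vertex (iterate-suc R e j)))) ⟩
      iterate R (ρ (iterate R e j)) j
        ≡⟨ backwards j (ℕ.<-trans (ℕ.n<1+n j) j<z) ⟩
      ρ e ∎

    -- The last step closes the line at `e`, which is also `s (s (s e))`; cancelling `s` identifies
    -- the dart along which the line comes back to `q`.
    last : ρ (iterate R e k) ≡ s (s e)
    last = σ-injective (σ-injective
      (trans (sym (iterate-suc R e k)) (trans (periodic per) (sym (q⇒s³-fixed e ve)))))

    -- The first `k` steps run the line of `e` backwards as far as `ρ e`. The final step crosses
    -- `q`, where it gives `s e` instead of closing up.
    sse⇝se : iterate R (s (s e)) z ≡ s e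
    sse⇝se = begin
      iterate R (s (s e)) (suc k)         ≡⟨ iterate-suc R (s (s e)) k ⟩
      R (iterate R (s (s e)) k)           ≡⟨ cong (λ x → R (iterate R x k)) last ⟨
      R (iterate R (ρ (iterate R e k)) k) ≡⟨ cong R (backwards k (ℕ.n<1+n k)) ⟩
      R (ρ e)                             ≡⟨ cong s (ρρ e) ⟩
      s e                                 ∎

    sse≢se : s (s e) ≢ s e
    sse≢se = q⇒s-≢ (s e) (trans (vertex-s e) ve)

    -- If `z` steps fixed `s e` or `s (s e)`, then `sse⇝se` would make these two darts equal.
    single : ∀ {d} → iterate R d z ≡ d → colour d ≡ colour e → vertex d ≡ q → e ~ d
    single {d} eq cd vd with three-at-q ve vd (sym cd)
    ... | inj₁ refl = ~-refl
    ... | inj₂ (inj₁ refl) =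
      contradiction (iterate-injective R R-injective z (trans sse⇝se (sym eq))) sse≢se
    ... | inj₂ (inj₂ refl) = contradiction (trans (sym eq) sse⇝se) sse≢se

  joined-⊥ : ∀ {e} → vertex e ≡ q → e ~ s e → e ~ s (s e) → ⊥
  joined-⊥ {e} ve e~se e~sse = single-orbit-⊥ {S = λ _ → ⊤} (λ _ → yes tt) _ _ _ ve tt (λ {d} → single {d})
    where
    single : ∀ {d} → ⊤ → colour d ≡ colour e → vertex d ≡ q → e ~ d
    single _ cd vd with three-at-q ve vd (sym cd)
    ... | inj₁ refl = ~-refl
    ... | inj₂ (inj₁ refl) = e~se
    ... | inj₂ (inj₂ refl) = e~sse

  -- Lying on one line is an equivalence relation on `e`, `s e` and `s (s e)`: unless it joins all
  -- three, one of them is alone. As `s` permutes them cyclically, that one can take the role of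
  -- `e`.
  impossible : ⊥
  impossible with e , ve ← IsOrbitMap.surjective vertex-isOrbitMap q = go e ve
    where
    go : ∀ e → vertex e ≡ q → ⊥
    go e ve with e ~? s e | e ~? s (s e)
    ... | no e≁se | no e≁sse = isolated-⊥ ve e≁se e≁sse
    ... | yes e~se | yes e~sse = joined-⊥ ve e~se e~sse
    ... | yes e~se | no e≁sse = isolated-⊥ (trans (vertex-s (s e)) (trans (vertex-s e) ve))
      (λ sse~ssse → e≁sse (~-sym (subst (s (s e) ~_) (q⇒s³-fixed e ve) sse~ssse)))
      (λ sse~sssse → e≁sse (~-trans e~se
        (~-sym (subst (s (s e) ~_) (cong s (q⇒s³-fixed e ve)) sse~sssse))))
    ... | no e≁se | yes e~sse = isolated-⊥ (trans (vertex-s e) ve)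
      (λ se~sse → e≁se (~-trans e~sse (~-sym se~sse)))
      (λ se~ssse → e≁se (~-sym (subst (s e ~_) (q⇒s³-fixed e ve) se~ssse)))

theorem5 : (M : OrientedMap) → OnTorus M → Is2,6-Quadrangulation M →
    (¬ (∃[ c ] AlternatesAroundFaces M c)) ×
    (∀ c → AlternatesAroundFaces M c ⇔ AlternatesAroundVertices M c)
theorem5 M _ (quadrilateral , p , q , degree-p , degree-q , degree-else) =
  (λ (c , alternates) →
    Bicoloured.impossible M quadrilateral p q degree-p degree-q degree-else c alternates)
  , alternation-⇔ M
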